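{- Let $t_1,\dots,t_n$ be basic terms, $\kappa$ a time variable, and $\Delta$ the saturation of the sample set $\{t_1[\kappa],\dots,t_n[\kappa]\}$. Then $\mathbf{W}\not\models\mathrm{id}\le t_1\vee\dots\vee t_n$ if, and only if, there exists a $\Delta$-diagram $\delta$ such that $\delta(\kappa)>\delta(t_i[\kappa])$ for all $i\in\{1,\dots,n\}$.
   Context: Let $\overline{\omega}=\omega\cup\{\omega\}$ with its natural order. A time warp is a function $f:\overline{\omega}\to\overline{\omega}$ preserving all suprema (equivalently monotone with $f(0)=0$ and $f(\omega)=\bigvee_{n\in\omega}f(n)$); $fg:=f\circ g$; $\mathrm{id}$ is the identity; $\bot$ is constant $0$; $\top$ maps $0\mapsto0$, $p\mapsto\omega$ for $p\ne0$; time warps are ordered pointwise with pointwise join $\vee$; the residuals satisfy $f\le h/g\iff fg\le h\iff g\le f\backslash h$; $f^{\ell}:=\mathrm{id}/f$, $f^{r}:=f\backslash\mathrm{id}$, $f^{o}:=\top\backslash f$. $\mathbf{W}$ denotes the algebra of time warps with these operations. Basic terms: $t,u::=x\mid tu\mid t^{o}\mid t^{\ell}\mid t^{r}\mid\mathrm{id}\mid\bot$ ($x$ a term variable), interpreted in $\mathbf{W}$ under any assignment of time warps to variables in the obvious way; $\mathbf{W}\models\mathrm{id}\le t_1\vee\dots\vee t_n$ means $\mathrm{id}\le t_1\vee\dots\vee t_n$ holds pointwise under every such assignment. Samples: $\alpha::=\kappa\mid t[\alpha]\mid\mathsf{s}(\alpha)\mid\mathsf{p}(\alpha)\mid\mathsf{last}(t)$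 with $\kappa$ a time variable and $t$ a basic term. The relation $\leadsto$: $t[\alpha]\leadsto\alpha$; $\mathsf{s}(\alpha)\leadsto\alpha$; $\mathsf{p}(\alpha)\leadsto\alpha$; $(tu)[\alpha]\leadsto t[u[\alpha]]$; $t^{o}[\alpha]\leadsto t[\alpha]$; $t^{r}[\alpha]\leadsto t[t^{r}[\alpha]],\ t[\mathsf{s}(t^{r}[\alpha])]$; $t^{\ell}[\alpha]\leadsto t[t^{\ell}[\alpha]],\ t[\mathsf{p}(t^{\ell}[\alpha])]$; $t[\alpha]\leadsto t[\mathsf{last}(t)]$. The saturation of a sample set $\Gamma$ is $\{\beta\mid\exists\alpha\in\Gamma,\ \alpha\leadsto^*\beta\}$ ($\leadsto^*$ the reflexive transitive closure). For $p\in\overline{\omega}$: $p\ominus1=p-1$ if $p\in\omega\setminus\{0\}$, else $p$; $p\oplus1=p+1$ if $p\in\omega$, else $p$. For a saturated sample set $\Delta$, a $\Delta$-diagram is a map $\delta:\Delta\to\overline{\omega}$ such that, for all samples mentioned lying in $\Delta$: (1) $\delta(\alpha)\le\delta(\beta)\Rightarrow\delta(t[\alpha])\le\delta(t[\beta])$; (2) $\delta(\alpha)=0\Rightarrow\delta(t[\alpha])=0$; (3) $\delta(\mathsf{p}(\alpha))=\delta(\alpha)\ominus1$; (4) $\delta(\mathsf{s}(\alpha))=\delta(\alpha)\oplus1$; (5) for $t[\alpha]\in\Delta$: $\delta(\mathsf{last}(t))\le\delta(\alpha)\iff\delta(t[\alpha])=\delta(t[\mathsf{last}(t)])$; (6)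 $\delta(\mathsf{last}(t))=\omega\Rightarrow\delta(t[\mathsf{last}(t)])=\omega$ for $t[\mathsf{last}(t)]\in\Delta$; (7) $\delta(\mathrm{id}[\alpha])=\delta(\alpha)$; (8) if $\bot[\alpha]\in\Delta$ then $\delta(\mathsf{last}(\bot))=0$; (9) $\delta((tu)[\alpha])=\delta(t[u[\alpha]])$; (10) for $(tu)[\mathsf{last}(tu)]\in\Delta$: $\delta(\mathsf{last}(tu))=\omega\Rightarrow\delta(\mathsf{last}(t))=\delta(\mathsf{last}(u))=\omega$; (11) $\delta(t^{o}[\alpha])\in\{0,\omega\}$; (12) $\delta(\alpha)<\omega\Rightarrow(\delta(t^{o}[\alpha])=\omega\iff\delta(t[\alpha])=\omega)$; (13) $\delta(\mathsf{last}(t^{o}))<\omega$; (14) for $t[\alpha],t^{o}[\mathsf{last}(t^{o})]\in\Delta$: $\delta(t^{o}[\mathsf{last}(t^{o})])<\omega$ and $\delta(\alpha)<\omega$ imply $\delta(t[\alpha])<\omega$; (15) $\delta(t[t^{r}[\alpha]])\le\delta(\alpha)$; (16) for $t^{r}[\alpha]\in\Delta$: $0<\delta(\alpha)<\omega$ and $\delta(t^{r}[\alpha])<\omega$ imply $\delta(\alpha)<\delta(t[\mathsf{s}(t^{r}[\alpha])])$; (17) for $t^{r}[\mathsf{last}(t^{r})]\in\Delta$: $\delta(\mathsf{last}(t^{r}))=\omega\Rightarrow\delta(\mathsf{last}(t))=\omega$; (18) for $t^{r}[\mathsf{last}(t^{r})]\in\Delta$: $\delta(t^{r}[\mathsf{last}(t^{r})])<\omega\Rightarrow\delta(t[\mathsf{s}(t^{r}[\mathsf{last}(t^{r})])])=\omega$;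 (19) for $t[t^{\ell}[\alpha]]\in\Delta$: $\delta(t^{\ell}[\alpha])<\omega\Rightarrow\delta(\alpha)\le\delta(t[t^{\ell}[\alpha]])$; (20) for $t^{\ell}[\alpha]\in\Delta$: $0<\delta(\alpha)<\omega$ and $\delta(t^{\ell}[\alpha])<\omega$ imply $\delta(t[\mathsf{p}(t^{\ell}[\alpha])])<\delta(\alpha)$; (21) for $t[t^{\ell}[\alpha]]\in\Delta$: $\delta(\alpha)<\omega$ and $\delta(t^{\ell}[\alpha])=\omega$ imply $\delta(t[t^{\ell}[\alpha]])<\delta(\alpha)$; (22) for $t^{\ell}[\mathsf{last}(t^{\ell})]\in\Delta$: $\delta(\mathsf{last}(t^{\ell}))=\omega\Rightarrow\delta(\mathsf{last}(t))=\omega$; (23) for $t^{\ell}[\mathsf{last}(t^{\ell})]\in\Delta$: $\delta(t^{\ell}[\mathsf{last}(t^{\ell})])<\omega\Rightarrow\delta(t[t^{\ell}[\mathsf{last}(t^{\ell})]])=\omega$. -}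

module Defs where

open import Data.Nat using (ℕ; zero; suc; _<_; _≤_)
import Data.Nat as N
open import Data.Fin using (Fin)
open import Data.Product using (Σ; ∃; _×_; _,_)
open import Data.Sum using (_⊎_)
open import Function.Bundles using (_⇔_)
open import Relation.Binary.PropositionalEquality using (_≡_)
open import Relation.Binary.Construct.Closure.ReflexiveTransitive using (Star)
open import Relation.Nullary using (¬_)

data ω̄ : Set where
  fin : ℕ → ω̄
  ω   : ω̄

infix 4 _≤ω_ _<ω_

data _≤ω_ : ω̄ → ω̄ → Set where
  fin≤fin : ∀ {m n} → m ≤ n → fin m ≤ω fin n
  _≤ω-top : ∀ p → p ≤ω ω

data _<ω_ : ω̄ → ω̄ → Set where
  fin<fin : ∀ {m n} → m < n → fin m <ω fin n
  fin<ω   : ∀ m → fin m <ω ω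

_⊔_ : ω̄ → ω̄ → ω̄
fin m ⊔ fin n = fin (m N.⊔ n)
fin m ⊔ ω     = ω
ω     ⊔ q     = ω

⋁ : ∀ {n} → (Fin n → ω̄) → ω̄
⋁ {zero}  a = fin 0
⋁ {suc n} a = a Fin.zero ⊔ ⋁ (λ i → a (Fin.suc i))
  where import Data.Fin as Fin

_⊖1 : ω̄ → ω̄
fin zero    ⊖1 = fin zero
fin (suc n) ⊖1 = fin n
ω           ⊖1 = ω

_⊕1 : ω̄ → ω̄
fin n ⊕1 = fin (suc n)
ω     ⊕1 = ω

IsSup : (ℕ → ω̄) → ω̄ → Set
IsSup s x = (∀ n → s n ≤ω x) × (∀ y → (∀ n → s n ≤ω y) → x ≤ω y)

record TimeWarp : Set where
  field
    fun    : ω̄ → ω̄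
    mono   : ∀ {p q} → p ≤ω q → fun p ≤ω fun q
    strict : fun (fin 0) ≡ fin 0
    cont   : IsSup (λ n → fun (fin n)) (fun ω)
open TimeWarp public

_≤W_ : TimeWarp → TimeWarp → Set
f ≤W g = ∀ p → fun f p ≤ω fun g p

topF : ω̄ → ω̄
topF (fin zero)    = fin zero
topF (fin (suc n)) = ω
topF ω             = ω

data Term : Set where
  var  : ℕ → Term
  _·_  : Term → Term → Term
  _ᵒ   : Term → Term
  _ˡ   : Term → Term
  _ʳ   : Term → Term
  idT  : Term
  ⊥T   : Term

Assignment : Set
Assignment = ℕ → TimeWarp

-- Interpretation of terms in W, as a relation characterised by the
-- defining (universal) properties; classically every term has exactly
-- one interpretation under a given assignment.
data ⟦_⟧_≈_ : Term → Assignment → TimeWarp → Set where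
  ⟦var⟧ : ∀ {ρ x f} → (∀ p → fun f p ≡ fun (ρ x) p) → ⟦ var x ⟧ ρ ≈ f
  ⟦·⟧   : ∀ {ρ t u g h f} → ⟦ t ⟧ ρ ≈ g → ⟦ u ⟧ ρ ≈ h →
          (∀ p → fun f p ≡ fun g (fun h p)) → ⟦ t · u ⟧ ρ ≈ f
  -- f = ⊤ \ g :  k ≤ f  ⇔  ⊤ k ≤ g
  ⟦ᵒ⟧   : ∀ {ρ t g f} → ⟦ t ⟧ ρ ≈ g →
          (∀ k → (k ≤W f) ⇔ (∀ p → topF (fun k p) ≤ω fun g p)) → ⟦ t ᵒ ⟧ ρ ≈ f
  -- f = id / g :  k ≤ f  ⇔  k g ≤ id
  ⟦ˡ⟧   : ∀ {ρ t g f} → ⟦ t ⟧ ρ ≈ g →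
          (∀ k → (k ≤W f) ⇔ (∀ p → fun k (fun g p) ≤ω p)) → ⟦ t ˡ ⟧ ρ ≈ f
  -- f = g \ id :  k ≤ f  ⇔  g k ≤ id
  ⟦ʳ⟧   : ∀ {ρ t g f} → ⟦ t ⟧ ρ ≈ g →
          (∀ k → (k ≤W f) ⇔ (∀ p → fun g (fun k p) ≤ω p)) → ⟦ t ʳ ⟧ ρ ≈ f
  ⟦id⟧  : ∀ {ρ f} → (∀ p → fun f p ≡ p) → ⟦ idT ⟧ ρ ≈ f
  ⟦⊥⟧   : ∀ {ρ f} → (∀ p → fun f p ≡ fin 0) → ⟦ ⊥T ⟧ ρ ≈ f

W⊨id≤⋁ : ∀ {n} → (Fin n → Term) → Set
W⊨id≤⋁ {n} ts =
  ∀ (ρ : Assignment) (fs : Fin n → TimeWarp) →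
  (∀ i → ⟦ ts i ⟧ ρ ≈ fs i) →
  ∀ p → p ≤ω ⋁ (λ i → fun (fs i) p)

data Sample : Set where
  tvar : ℕ → Sample
  _[_] : Term → Sample → Sample
  s    : Sample → Sample
  pr   : Sample → Sample
  last : Term → Sample

data _↝_ : Sample → Sample → Set where
  app↝  : ∀ t α → (t [ α ]) ↝ α
  s↝    : ∀ α → s α ↝ α
  p↝    : ∀ α → pr α ↝ α
  ·↝    : ∀ t u α → ((t · u) [ α ]) ↝ (t [ u [ α ] ])
  ᵒ↝    : ∀ t α → ((t ᵒ) [ α ]) ↝ (t [ α ])
  ʳ↝₁   : ∀ t α → ((t ʳ) [ α ]) ↝ (t [ (t ʳ) [ α ] ])
  ʳ↝₂   : ∀ t α → ((t ʳ) [ α ]) ↝ (t [ s ((t ʳ) [ α ]) ])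
  ˡ↝₁   : ∀ t α → ((t ˡ) [ α ]) ↝ (t [ (t ˡ) [ α ] ])
  ˡ↝₂   : ∀ t α → ((t ˡ) [ α ]) ↝ (t [ pr ((t ˡ) [ α ]) ])
  last↝ : ∀ t α → (t [ α ]) ↝ (t [ last t ])

_↝*_ : Sample → Sample → Set
_↝*_ = Star _↝_

Saturation : (Sample → Set) → Sample → Set
Saturation Γ β = ∃ λ α → Γ α × (α ↝* β)

InitSamples : ∀ {n} → (Fin n → Term) → ℕ → Sample → Set
InitSamples ts κ α = ∃ λ i → α ≡ (ts i [ tvar κ ])

-- Δ-diagrams.  A diagram is represented as a total map Sample → ω̄
-- whose values outside Δ are irrelevant (every condition is required
-- only when all samples mentioned in it lie in Δ).

record IsDiagram (Δ : Sample → Set) (δ : Sample → ω̄) : Set where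
  field
    c1  : ∀ t α β → Δ (t [ α ]) → Δ (t [ β ]) → Δ α → Δ β →
          δ α ≤ω δ β → δ (t [ α ]) ≤ω δ (t [ β ])
    c2  : ∀ t α → Δ (t [ α ]) → Δ α → δ α ≡ fin 0 → δ (t [ α ]) ≡ fin 0
    c3  : ∀ α → Δ (pr α) → Δ α → δ (pr α) ≡ δ α ⊖1
    c4  : ∀ α → Δ (s α) → Δ α → δ (s α) ≡ δ α ⊕1
    c5  : ∀ t α → Δ (t [ α ]) → Δ α → Δ (last t) → Δ (t [ last t ]) →
          (δ (last t) ≤ω δ α) ⇔ (δ (t [ α ]) ≡ δ (t [ last t ]))
    c6  : ∀ t → Δ (t [ last t ]) → Δ (last t) →
          δ (last t) ≡ ω → δ (t [ last t ]) ≡ ω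
    c7  : ∀ α → Δ (idT [ α ]) → Δ α → δ (idT [ α ]) ≡ δ α
    c8  : ∀ α → Δ (⊥T [ α ]) → Δ (last ⊥T) → δ (last ⊥T) ≡ fin 0
    c9  : ∀ t u α → Δ ((t · u) [ α ]) → Δ (t [ u [ α ] ]) →
          δ ((t · u) [ α ]) ≡ δ (t [ u [ α ] ])
    c10 : ∀ t u → Δ ((t · u) [ last (t · u) ]) → Δ (last (t · u)) →
          Δ (last t) → Δ (last u) →
          δ (last (t · u)) ≡ ω → (δ (last t) ≡ ω) × (δ (last u) ≡ ω)
    c11 : ∀ t α → Δ ((t ᵒ) [ α ]) →
          (δ ((t ᵒ) [ α ]) ≡ fin 0) ⊎ (δ ((t ᵒ) [ α ]) ≡ ω)
    c12 : ∀ t α → Δ ((t ᵒ) [ α ]) → Δ (t [ α ]) → Δ α → δ α <ω ω →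
          (δ ((t ᵒ) [ α ]) ≡ ω) ⇔ (δ (t [ α ]) ≡ ω)
    c13 : ∀ t → Δ (last (t ᵒ)) → δ (last (t ᵒ)) <ω ω
    c14 : ∀ t α → Δ (t [ α ]) → Δ ((t ᵒ) [ last (t ᵒ) ]) → Δ α →
          δ ((t ᵒ) [ last (t ᵒ) ]) <ω ω → δ α <ω ω → δ (t [ α ]) <ω ω
    c15 : ∀ t α → Δ (t [ (t ʳ) [ α ] ]) → Δ α →
          δ (t [ (t ʳ) [ α ] ]) ≤ω δ α
    c16 : ∀ t α → Δ ((t ʳ) [ α ]) → Δ α → Δ (t [ s ((t ʳ) [ α ]) ]) →
          fin 0 <ω δ α → δ α <ω ω → δ ((t ʳ) [ α ]) <ω ω →
          δ α <ω δ (t [ s ((t ʳ) [ α ]) ])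
    c17 : ∀ t → Δ ((t ʳ) [ last (t ʳ) ]) → Δ (last (t ʳ)) → Δ (last t) →
          δ (last (t ʳ)) ≡ ω → δ (last t) ≡ ω
    c18 : ∀ t → Δ ((t ʳ) [ last (t ʳ) ]) →
          Δ (t [ s ((t ʳ) [ last (t ʳ) ]) ]) →
          δ ((t ʳ) [ last (t ʳ) ]) <ω ω →
          δ (t [ s ((t ʳ) [ last (t ʳ) ]) ]) ≡ ω
    c19 : ∀ t α → Δ (t [ (t ˡ) [ α ] ]) → Δ ((t ˡ) [ α ]) → Δ α →
          δ ((t ˡ) [ α ]) <ω ω → δ α ≤ω δ (t [ (t ˡ) [ α ] ])
    c20 : ∀ t α → Δ ((t ˡ) [ α ]) → Δ α → Δ (t [ pr ((t ˡ) [ α ]) ]) →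
          fin 0 <ω δ α → δ α <ω ω → δ ((t ˡ) [ α ]) <ω ω →
          δ (t [ pr ((t ˡ) [ α ]) ]) <ω δ α
    c21 : ∀ t α → Δ (t [ (t ˡ) [ α ] ]) → Δ ((t ˡ) [ α ]) → Δ α →
          δ α <ω ω → δ ((t ˡ) [ α ]) ≡ ω → δ (t [ (t ˡ) [ α ] ]) <ω δ α
    c22 : ∀ t → Δ ((t ˡ) [ last (t ˡ) ]) → Δ (last (t ˡ)) → Δ (last t) →
          δ (last (t ˡ)) ≡ ω → δ (last t) ≡ ω
    c23 : ∀ t → Δ ((t ˡ) [ last (t ˡ) ]) →
          Δ (t [ (t ˡ) [ last (t ˡ) ] ]) →
          δ ((t ˡ) [ last (t ˡ) ]) <ω ω →
          δ (t [ (t ˡ) [ last (t ˡ) ] ]) ≡ ω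

{-# OPTIONS --safe #-}
module Submission where

-- A refutation yields a diagram by evaluating samples, with last(t) sent to the least
-- argument at which the value of t equals its value at ω.  Conversely, a saturation is
-- finite, so the finitely many values that a diagram prescribes for a variable extend to
-- a time warp, which can be chosen so that it reaches its supremum only at ω whenever
-- last(x) is sent to ω.  The remaining conditions carry both properties from subterms to
-- terms, so the diagram is the evaluation of the terms under that assignment.

open import Defs
open import Data.Nat using (ℕ; zero; suc; _≤_; _<_; z≤n; s≤s)
import Data.Nat as N
import Data.Nat.Properties as NP
open import Data.Nat.Induction using (<-rec)
open import Data.Fin using (Fin)
import Data.Fin as F
open import Data.Product using (∃; _×_; _,_; proj₁; proj₂)
open import Data.Sum using (_⊎_; inj₁; inj₂)
open import Data.Empty using (⊥-elim)
open import Data.List using (List; []; _∷_; _++_; concat; tabulate)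
open import Data.List.Membership.Propositional using (_∈_)
open import Data.List.Membership.Propositional.Properties using 
  (∈-++⁺ˡ; ∈-++⁺ʳ; ∈-++⁻; ∈-concat⁺′; ∈-tabulate⁺)
open import Data.List.Relation.Unary.Any using (here; there)
open import Function.Base using (_∘_)
open import Function.Bundles using (_⇔_; mk⇔; Equivalence)
open import Relation.Binary.Construct.Closure.ReflexiveTransitive using (ε; _◅_; _◅◅_)
open import Relation.Binary.PropositionalEquality
  using (_≡_; _≢_; refl; sym; trans; cong; subst)
open import Relation.Nullary using (¬_; yes; no)
open import Level using (0ℓ)
open import Axiom.ExcludedMiddle using (ExcludedMiddle)

open Equivalence using (to; from)

-- The obstacle is the value of a residual at ω. Being a supremum over all finite arguments, it
-- depends on the warp at arguments that no sample attains, so agreement with a diagram on its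
-- samples is too weak an induction hypothesis; `Unlimited` is the extra information carried along.
-- Finiteness of the saturation enters only through a bound on the finite values of the diagram:
-- past that bound a variable's warp may grow freely. Evaluation needs `Unlimited` to pass from a
-- composite or residual to its components, realisation needs the opposite passage.

≤ω-refl : ∀ {p} → p ≤ω p
≤ω-refl {fin n} = fin≤fin NP.≤-refl
≤ω-refl {ω}     = ω ≤ω-top

≤ω-reflexive : ∀ {p q} → p ≡ q → p ≤ω q
≤ω-reflexive refl = ≤ω-refl

≤ω-trans : ∀ {p q r} → p ≤ω q → q ≤ω r → p ≤ω r
≤ω-trans (fin≤fin a) (fin≤fin b) = fin≤fin (NP.≤-trans a b)
≤ω-trans {p} _       (_ ≤ω-top)  = p ≤ω-top

≤ω-antisym : ∀ {p q} → p ≤ω q → q ≤ω p → p ≡ q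
≤ω-antisym (fin≤fin a) (fin≤fin b)  = cong fin (NP.≤-antisym a b)
≤ω-antisym (.ω ≤ω-top) (.ω ≤ω-top) = refl

0≤ω : ∀ {p} → fin 0 ≤ω p
0≤ω {fin n} = fin≤fin z≤n
0≤ω {ω}     = fin 0 ≤ω-top

≤0⇒≡0 : ∀ {p} → p ≤ω fin 0 → p ≡ fin 0
≤0⇒≡0 p≤0 = ≤ω-antisym p≤0 0≤ω

fin≤⁻¹ : ∀ {m n} → fin m ≤ω fin n → m ≤ n
fin≤⁻¹ (fin≤fin a) = a

0≢ω : fin 0 ≢ ω
0≢ω ()

ω≰fin : ∀ {n} → ¬ (ω ≤ω fin n)
ω≰fin ()

ω≤⇒≡ω : ∀ {p} → ω ≤ω p → p ≡ ω
ω≤⇒≡ω (.ω ≤ω-top) = refl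

unbounded⇒≡ω : ∀ {p} → (∀ n → fin n ≤ω p) → p ≡ ω
unbounded⇒≡ω {fin n} h = ⊥-elim (NP.<-irrefl refl (fin≤⁻¹ (h (suc n))))
unbounded⇒≡ω {ω}     h = refl

<ω⇒≱ω : ∀ {p q} → p <ω q → ¬ (q ≤ω p)
<ω⇒≱ω (fin<fin a) (fin≤fin b) = NP.<⇒≱ a b
<ω⇒≱ω (fin<ω m)   ()

≰ω⇒>ω : ∀ {p q} → ¬ (p ≤ω q) → q <ω p
≰ω⇒>ω {fin m} {fin n} h = fin<fin (NP.≰⇒> (h ∘ fin≤fin))
≰ω⇒>ω {p}     {ω}     h = ⊥-elim (h (p ≤ω-top))
≰ω⇒>ω {ω}     {fin n} h = fin<ω n

<ω⇒≤ω : ∀ {p q} → p <ω q → p ≤ω q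
<ω⇒≤ω (fin<fin a) = fin≤fin (NP.<⇒≤ a)
<ω⇒≤ω (fin<ω m)   = fin m ≤ω-top

<ω⇒suc≤ω : ∀ {m q} → fin m <ω q → fin (suc m) ≤ω q
<ω⇒suc≤ω (fin<fin a) = fin≤fin a
<ω⇒suc≤ω (fin<ω m)   = fin (suc m) ≤ω-top

≰ω⇒suc≤ω : ∀ {m q} → ¬ (q ≤ω fin m) → fin (suc m) ≤ω q
≰ω⇒suc≤ω h = <ω⇒suc≤ω (≰ω⇒>ω h)

suc≰ω : ∀ {m} → ¬ (fin (suc m) ≤ω fin m)
suc≰ω h = NP.<-irrefl refl (fin≤⁻¹ h)

finite? : ∀ p → (∃ λ n → p ≡ fin n) ⊎ p ≡ ω
finite? (fin n) = inj₁ (n , refl)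
finite? ω       = inj₂ refl

<ω-top⇒fin : ∀ {p} → p <ω ω → ∃ λ n → p ≡ fin n
<ω-top⇒fin (fin<ω m) = m , refl

fin⇒<ω-top : ∀ {p n} → p ≡ fin n → p <ω ω
fin⇒<ω-top refl = fin<ω _

≢ω⇒<ω-top : ∀ {p} → p ≢ ω → p <ω ω
≢ω⇒<ω-top {fin n} _ = fin<ω n
≢ω⇒<ω-top {ω}     h = ⊥-elim (h refl)

<ω-top⇒≢ω : ∀ {p} → p <ω ω → p ≢ ω
<ω-top⇒≢ω (fin<ω m) ()

≤ω-<ω-top : ∀ {p q} → p ≤ω q → q <ω ω → p <ω ω
≤ω-<ω-top (fin≤fin _) (fin<ω n) = fin<ω _

⊔-lub-<ω : ∀ {p q r} → p <ω r → q <ω r → (p ⊔ q) <ω r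
⊔-lub-<ω (fin<fin a) (fin<fin b) = fin<fin (NP.⊔-lub a b)
⊔-lub-<ω (fin<ω m)   (fin<ω n)   = fin<ω (m N.⊔ n)

p≤p⊔q : ∀ p q → p ≤ω (p ⊔ q)
p≤p⊔q (fin m) (fin n) = fin≤fin (NP.m≤m⊔n m n)
p≤p⊔q (fin m) ω       = fin m ≤ω-top
p≤p⊔q ω       q       = ω ≤ω-top

q≤p⊔q : ∀ p q → q ≤ω (p ⊔ q)
q≤p⊔q (fin m) (fin n) = fin≤fin (NP.m≤n⊔m m n)
q≤p⊔q (fin m) ω       = ω ≤ω-top
q≤p⊔q ω       q       = q ≤ω-top

⋁-upper : ∀ {n} (a : Fin n → ω̄) i → a i ≤ω ⋁ a
⋁-upper a F.zero    = p≤p⊔q (a F.zero) _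
⋁-upper a (F.suc i) = ≤ω-trans (⋁-upper (a ∘ F.suc) i) (q≤p⊔q (a F.zero) _)

⋁-<ω : ∀ {n} (a : Fin n → ω̄) {p} → fin 0 <ω p → (∀ i → a i <ω p) → ⋁ a <ω p
⋁-<ω {zero}  a 0<p h = 0<p
⋁-<ω {suc n} a 0<p h = ⊔-lub-<ω (h F.zero) (⋁-<ω (a ∘ F.suc) 0<p (h ∘ F.suc))

-- Time warps: finite arguments, identity, bottom, greatest solutions

cont-lub : ∀ f {y} → (∀ n → fun f (fin n) ≤ω y) → fun f ω ≤ω y
cont-lub f = proj₂ (cont f) _

≤W-from-finite : ∀ f g → (∀ n → fun f (fin n) ≤ω fun g (fin n)) → f ≤W g
≤W-from-finite f g h (fin n) = h n
≤W-from-finite f g h ω       = cont-lub f λ n → ≤ω-trans (h n) (mono g (fin n ≤ω-top))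

≤W-antisym : ∀ f g → f ≤W g → g ≤W f → ∀ p → fun f p ≡ fun g p
≤W-antisym f g h k p = ≤ω-antisym (h p) (k p)

-- For a time warp, this says that f p ≡ f ω holds only at p = ω.
Unlimited : TimeWarp → Set
Unlimited f = (∀ n → fun f (fin n) <ω ω) × fun f ω ≡ ω

finite-approx : ∀ f p {y} → (∀ n → fin n ≤ω p → fun f (fin n) ≤ω y) → fun f p ≤ω y
finite-approx f (fin k) h = h k ≤ω-refl
finite-approx f ω       h = cont-lub f λ n → h n (fin n ≤ω-top)

idW : TimeWarp
fun    idW p = p
mono   idW h = h
strict idW = refl
cont   idW = (λ n → fin n ≤ω-top) , λ y h → ≤ω-reflexive (sym (unbounded⇒≡ω h))

⊥W : TimeWarp
fun    ⊥W p = fin 0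
mono   ⊥W h = ≤ω-refl
strict ⊥W = refl
cont   ⊥W = (λ n → ≤ω-refl) , λ y h → h 0

Unlimited-idW : Unlimited idW
Unlimited-idW = (λ n → fin<ω n) , refl

IsGreatest : TimeWarp → (TimeWarp → Set) → Set
IsGreatest f K = ∀ k → (k ≤W f) ⇔ K k

≤W-refl : ∀ f → f ≤W f
≤W-refl f p = ≤ω-refl

-- Two predicates are compared because a subterm's interpretation agrees with `interp` only
-- pointwise, so the residual conditions are equivalent rather than identical.
IsGreatest-unique : ∀ f g {K L : TimeWarp → Set} →
  IsGreatest f K → IsGreatest g L → (∀ k → K k → L k) → (∀ k → L k → K k) →
  ∀ p → fun f p ≡ fun g p
IsGreatest-unique f g F G K⇒L L⇒K = ≤W-antisym f g
  (from (G f) (K⇒L f (to (F f) (≤W-refl f))))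
  (from (F g) (L⇒K g (to (G g) (≤W-refl g))))

topF-≤ : ∀ {p q} → (p ≢ fin 0 → q ≡ ω) → topF p ≤ω q
topF-≤ {fin zero}  h = 0≤ω
topF-≤ {fin (suc n)} h = ≤ω-reflexive (sym (h λ ()))
topF-≤ {ω}         h = ≤ω-reflexive (sym (h λ ()))

topF-≤⁻¹ : ∀ {p q} → topF p ≤ω q → q ≢ ω → p ≡ fin 0
topF-≤⁻¹ {fin zero}    h q≢ω = refl
topF-≤⁻¹ {fin (suc n)} h q≢ω = ⊥-elim (q≢ω (ω≤⇒≡ω h))
topF-≤⁻¹ {ω}           h q≢ω = ⊥-elim (q≢ω (ω≤⇒≡ω h))

module Classical (em : ExcludedMiddle 0ℓ) where

  -- Least elements and suprema in ω̄

  by-contradiction : {P : Set} → ¬ ¬ P → P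
  by-contradiction {P} h with em {P}
  ... | yes p = p
  ... | no ¬p = ⊥-elim (h ¬p)

  least-number : ∀ (P : ℕ → Set) n → P n → ∃ λ m → P m × (∀ k → P k → m ≤ k)
  least-number P = <-rec _ step
    where
    step : ∀ n → (∀ {m} → m < n → P m → ∃ λ m → P m × (∀ k → P k → m ≤ k)) →
           P n → ∃ λ m → P m × (∀ k → P k → m ≤ k)
    step n rec Pn with em {∃ λ m → m < n × P m}
    ... | yes (m , m<n , Pm) = rec m<n Pm
    ... | no  ¬∃ = n , Pn , λ k Pk → NP.≮⇒≥ λ k<n → ¬∃ (k , k<n , Pk)

  least-spec : ∀ (P : ω̄ → Set) →
    ∃ λ p → (∀ q → P q → p ≤ω q) × (∀ n → p ≡ fin n → P (fin n))
  least-spec P with em {∃ λ n → P (fin n)}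
  ... | yes (n , Pn) with least-number (P ∘ fin) n Pn
  ...   | m , Pm , m≤ = fin m , lower , λ { _ refl → Pm }
    where
    lower : ∀ q → P q → fin m ≤ω q
    lower (fin k) Pk = fin≤fin (m≤ k Pk)
    lower ω       _  = fin m ≤ω-top
  least-spec P | no ¬∃ = ω , lower , λ { _ () }
    where
    lower : ∀ q → P q → ω ≤ω q
    lower (fin k) Pk = ⊥-elim (¬∃ (k , Pk))
    lower ω       _  = ω ≤ω-top

  -- Equal to ω when P holds nowhere.
  least : (ω̄ → Set) → ω̄
  least P = proj₁ (least-spec P)

  least-≤ : ∀ P {q} → P q → least P ≤ω q
  least-≤ P = proj₁ (proj₂ (least-spec P)) _

  least-∈ : ∀ P {n} → least P ≡ fin n → P (fin n)
  least-∈ P = proj₂ (proj₂ (least-spec P)) _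

  least-∈-top : ∀ P → P ω → P (least P)
  least-∈-top P Pω with finite? (least P)
  ... | inj₁ (n , eq) = subst P (sym eq) (least-∈ P eq)
  ... | inj₂ eq       = subst P (sym eq) Pω

  least-antitone : ∀ P Q → (∀ q → Q q → P q) → least P ≤ω least Q
  least-antitone P Q Q⇒P with finite? (least Q)
  ... | inj₁ (n , eq) = subst (least P ≤ω_) (sym eq) (least-≤ P (Q⇒P _ (least-∈ Q eq)))
  ... | inj₂ eq       = subst (least P ≤ω_) (sym eq) (least P ≤ω-top)

  UpperBound : {I : Set} → (I → ω̄) → ω̄ → Set
  UpperBound a y = ∀ i → a i ≤ω y

  sup : {I : Set} → (I → ω̄) → ω̄
  sup a = least (UpperBound a)

  sup-upper : {I : Set} (a : I → ω̄) → ∀ i → a i ≤ω sup a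
  sup-upper a = least-∈-top (UpperBound a) (λ i → a i ≤ω-top)

  sup-lub : {I : Set} (a : I → ω̄) {y : ω̄} → (∀ i → a i ≤ω y) → sup a ≤ω y
  sup-lub a = least-≤ (UpperBound a)

  sup-mono : {I J : Set} (a : I → ω̄) (b : J → ω̄) →
             (∀ i → ∃ λ j → a i ≤ω b j) → sup a ≤ω sup b
  sup-mono a b h = sup-lub a λ i → ≤ω-trans (proj₂ (h i)) (sup-upper b (proj₁ (h i)))

  -- The threshold is positive because the family may be empty: its supremum is then 0, which no
  -- index witnesses.
  sup-approx : {I : Set} (a : I → ω̄) → ∀ {m} → fin (suc m) ≤ω sup a → ∃ λ i → fin (suc m) ≤ω a i
  sup-approx a {m} h = by-contradiction λ ¬∃ →
    suc≰ω (≤ω-trans h (sup-lub a λ i → by-contradiction λ ai≰m → ¬∃ (i , ≰ω⇒suc≤ω ai≰m)))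

  -- A finite number below the supremum is either 0, settled by strictness even for an empty family,
  -- or lies below some `a i`.
  preserves-sup : ∀ f {I : Set} (a : I → ω̄) {y} → (∀ i → fun f (a i) ≤ω y) → fun f (sup a) ≤ω y
  preserves-sup f a {y} h = finite-approx f (sup a) bound
    where
    bound : ∀ n → fin n ≤ω sup a → fun f (fin n) ≤ω y
    bound zero    _  = subst (_≤ω y) (sym (strict f)) 0≤ω
    bound (suc m) le with sup-approx a le
    ... | i , le′ = ≤ω-trans (mono f le′) (h i)

  -- Extension from finite arguments, and composition

  extend : (F : ℕ → ω̄) → (∀ {m n} → m ≤ n → F m ≤ω F n) → F 0 ≡ fin 0 → TimeWarp
  extend F F-mono F-zero = record
    { fun = G ; mono = G-mono ; strict = F-zero ; cont = sup-upper F , λ y → sup-lub F }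
    where
    G : ω̄ → ω̄
    G (fin n) = F n
    G ω       = sup F
    G-mono : ∀ {p q} → p ≤ω q → G p ≤ω G q
    G-mono (fin≤fin h)       = F-mono h
    G-mono (fin n ≤ω-top) = sup-upper F n
    G-mono (ω ≤ω-top)     = ≤ω-refl

  approx : ∀ f n → fin n ≤ω fun f ω → ∃ λ m → fin n ≤ω fun f (fin m)
  approx f zero    h = 0 , 0≤ω
  approx f (suc n) h = by-contradiction λ ¬∃ →
    suc≰ω (≤ω-trans h (cont-lub f λ m → by-contradiction λ h′ → ¬∃ (m , ≰ω⇒suc≤ω h′)))

  _∘W_ : TimeWarp → TimeWarp → TimeWarp
  fun    (f ∘W g) = fun f ∘ fun g
  mono   (f ∘W g) = mono f ∘ mono g
  strict (f ∘W g) = trans (cong (fun f) (strict g)) (strict f)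
  cont   (f ∘W g) = (λ n → mono f (mono g (fin n ≤ω-top))) , λ y h →
    finite-approx f (fun g ω) λ n le →
      let m , n≤gm = approx g n le in ≤ω-trans (mono f n≤gm) (h m)

  Unlimited-∘ : ∀ f g → Unlimited f → Unlimited g → Unlimited (f ∘W g)
  Unlimited-∘ f g (f<ω , fω) (g<ω , gω) =
    (λ n → let m , eq = <ω-top⇒fin (g<ω n) in subst (λ q → fun f q <ω ω) (sym eq) (f<ω m)) ,
    trans (cong (fun f) gω) fω

  -- Were `g ω` finite, `g` would attain it at a finite argument, where the composite would already
  -- be infinite. So `g` is unbounded, and each finite value of `f` lies below one of the composite.
  Unlimited-∘⁻¹ : ∀ f g → Unlimited (f ∘W g) → Unlimited f × Unlimited g
  Unlimited-∘⁻¹ f g (fg<ω , fgω) = (f<ω , fω) , (g<ω , gω)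
    where
    fω : fun f ω ≡ ω
    fω = ω≤⇒≡ω (subst (_≤ω fun f ω) fgω (mono f (fun g ω ≤ω-top)))
    g<ω : ∀ n → fun g (fin n) <ω ω
    g<ω n = ≢ω⇒<ω-top λ eq → <ω-top⇒≢ω (fg<ω n) (trans (cong (fun f) eq) fω)
    gω : fun g ω ≡ ω
    gω with finite? (fun g ω)
    ... | inj₂ eq = eq
    ... | inj₁ (k , eq) with approx g k (≤ω-reflexive (sym eq))
    ...   | m , k≤gm = ⊥-elim (<ω⇒≱ω (fg<ω m)
              (subst (_≤ω fun f (fun g (fin m))) (trans (cong (fun f) (sym eq)) fgω) (mono f k≤gm)))
    f<ω : ∀ n → fun f (fin n) <ω ω
    f<ω n with approx g n (subst (fin n ≤ω_) (sym gω) (fin n ≤ω-top))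
    ... | m , n≤gm = ≤ω-<ω-top (mono f n≤gm) (fg<ω m)

  -- Least arguments attaining the value at ω

  lastW : TimeWarp → ω̄
  lastW f = least (λ p → fun f p ≡ fun f ω)

  fun-lastW : ∀ f → fun f (lastW f) ≡ fun f ω
  fun-lastW f = least-∈-top (λ p → fun f p ≡ fun f ω) refl

  lastW-≤⇔ : ∀ f p → (lastW f ≤ω p) ⇔ (fun f p ≡ fun f (lastW f))
  lastW-≤⇔ f p = mk⇔
    (λ le → ≤ω-antisym (subst (fun f p ≤ω_) (sym (fun-lastW f)) (mono f (p ≤ω-top))) (mono f le))
    (λ eq → least-≤ (λ p → fun f p ≡ fun f ω) (trans eq (fun-lastW f)))

  -- A finite value `f ω` would be attained at a finite argument by `approx`, and an infinite value
  -- at a finite argument would equal `f ω`; either contradicts that `lastW f` is ω.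
  lastW≡ω⇒Unlimited : ∀ f → lastW f ≡ ω → Unlimited f
  lastW≡ω⇒Unlimited f eq = (λ n → ≢ω⇒<ω-top λ e → nonlast n (trans e (sym fω))) , fω
    where
    nonlast : ∀ n → fun f (fin n) ≢ fun f ω
    nonlast n e = ω≰fin (subst (_≤ω fin n) eq (least-≤ (λ p → fun f p ≡ fun f ω) e))
    fω : fun f ω ≡ ω
    fω with finite? (fun f ω)
    ... | inj₂ e = e
    ... | inj₁ (k , e) with approx f k (≤ω-reflexive (sym e))
    ...   | m , k≤fm = ⊥-elim (nonlast m (≤ω-antisym (mono f (fin m ≤ω-top))
              (subst (_≤ω fun f (fin m)) (sym e) k≤fm)))

  Unlimited⇒lastW≡ω : ∀ f → Unlimited f → lastW f ≡ ω
  Unlimited⇒lastW≡ω f (f<ω , fω) with finite? (lastW f)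
  ... | inj₂ e = e
  ... | inj₁ (n , e) = ⊥-elim (<ω-top⇒≢ω (f<ω n)
          (trans (trans (cong (fun f) (sym e)) (fun-lastW f)) fω))

  -- ⊤ \ f

  -- The least such y is ω or 0 according to whether f is infinite at n. The form of an implication
  -- reduces monotonicity of `ores` to `least-antitone`.
  InfiniteAt : TimeWarp → ℕ → ω̄ → Set
  InfiniteAt f n y = fun f (fin n) ≡ ω → y ≡ ω

  ores : TimeWarp → TimeWarp
  ores f = extend (λ n → least (InfiniteAt f n))
    (λ {m} {n} m≤n → least-antitone (InfiniteAt f m) (InfiniteAt f n) λ q h e →
      h (ω≤⇒≡ω (subst (_≤ω fun f (fin n)) e (mono f (fin≤fin m≤n)))))
    (≤0⇒≡0 (least-≤ (InfiniteAt f 0) λ e → ⊥-elim (0≢ω (trans (sym (strict f)) e))))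

  ores-fin-0 : ∀ f n → fun f (fin n) ≢ ω → fun (ores f) (fin n) ≡ fin 0
  ores-fin-0 f n h = ≤0⇒≡0 (least-≤ (InfiniteAt f n) λ e → ⊥-elim (h e))

  ores-fin-ω : ∀ f n → fun f (fin n) ≡ ω → fun (ores f) (fin n) ≡ ω
  ores-fin-ω f n e = least-∈-top (InfiniteAt f n) (λ _ → refl) e

  ores-fin-ω⇔ : ∀ f n → (fun (ores f) (fin n) ≡ ω) ⇔ (fun f (fin n) ≡ ω)
  ores-fin-ω⇔ f n = mk⇔
    (λ e → by-contradiction λ h → 0≢ω (trans (sym (ores-fin-0 f n h)) e))
    (ores-fin-ω f n)

  ores-0-or-ω : ∀ f p → fun (ores f) p ≡ fin 0 ⊎ fun (ores f) p ≡ ω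
  ores-0-or-ω f (fin n) with em {fun f (fin n) ≡ ω}
  ... | yes e = inj₂ (ores-fin-ω f n e)
  ... | no  h = inj₁ (ores-fin-0 f n h)
  ores-0-or-ω f ω with em {∃ λ n → fun f (fin n) ≡ ω}
  ... | yes (n , e) = inj₂ (ω≤⇒≡ω (subst (_≤ω fun (ores f) ω) (ores-fin-ω f n e)
                        (mono (ores f) (fin n ≤ω-top))))
  ... | no  h = inj₁ (≤0⇒≡0 (cont-lub (ores f) λ n →
                  ≤ω-reflexive (ores-fin-0 f n λ e → h (n , e))))

  -- A nonzero value at ω requires a finite argument at which f is infinite. The converse fails at
  -- ω: for the identity warp the residual is constantly 0.
  ores-≢0 : ∀ f p → fun (ores f) p ≢ fin 0 → fun f p ≡ ω
  ores-≢0 f (fin n) h = by-contradiction (h ∘ ores-fin-0 f n)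
  ores-≢0 f ω       h = by-contradiction λ fω≢ω → h (≤0⇒≡0 (cont-lub (ores f) λ n →
    ≤ω-reflexive (ores-fin-0 f n λ e →
      fω≢ω (ω≤⇒≡ω (subst (_≤ω fun f ω) e (mono f (fin n ≤ω-top)))))))

  ores-greatest : ∀ f → IsGreatest (ores f) (λ k → ∀ p → topF (fun k p) ≤ω fun f p)
  ores-greatest f k = mk⇔
    (λ k≤f p → topF-≤ λ kp≢0 → ores-≢0 f p λ e →
      kp≢0 (≤0⇒≡0 (subst (fun k p ≤ω_) e (k≤f p))))
    (λ h → ≤W-from-finite k (ores f) (below h))
    where
    below : (∀ p → topF (fun k p) ≤ω fun f p) → ∀ n → fun k (fin n) ≤ω fun (ores f) (fin n)
    below h n with em {fun f (fin n) ≡ ω}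
    ... | yes e = subst (fun k (fin n) ≤ω_) (sym (ores-fin-ω f n e)) (fun k (fin n) ≤ω-top)
    ... | no ¬e = subst (_≤ω fun (ores f) (fin n)) (sym (topF-≤⁻¹ (h (fin n)) ¬e)) 0≤ω

  ¬Unlimited-ores : ∀ f → ¬ Unlimited (ores f)
  ¬Unlimited-ores f (o<ω , oω) = ω≰fin (subst (_≤ω fin 0) oω (cont-lub (ores f) zero-at))
    where
    zero-at : ∀ n → fun (ores f) (fin n) ≤ω fin 0
    zero-at n with ores-0-or-ω f (fin n)
    ... | inj₁ e = ≤ω-reflexive e
    ... | inj₂ e = ⊥-elim (<ω-top⇒≢ω (o<ω n) e)

  -- f \ id

  -- The factor `0 < n` empties the family at 0, so that the residual is strict; otherwise the
  -- supremum of all q with `f q` = 0 could be positive.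
  Below : TimeWarp → ℕ → Set
  Below f n = ∃ λ q → 0 < n × fun f q ≤ω fin n

  rres : TimeWarp → TimeWarp
  rres f = extend (λ n → sup {Below f n} proj₁)
    (λ m≤n → sup-mono proj₁ proj₁ λ { (q , 0<m , le) →
      (q , NP.≤-trans 0<m m≤n , ≤ω-trans le (fin≤fin m≤n)) , ≤ω-refl })
    (≤0⇒≡0 (sup-lub {Below f 0} proj₁ λ { (_ , () , _) }))

  -- Since `f` preserves suprema, the supremum defining the residual is itself a solution of the
  -- defining inequality.
  rres-lower : ∀ f p → fun f (fun (rres f) p) ≤ω p
  rres-lower f (fin n) = preserves-sup f {Below f n} proj₁ λ { (q , _ , le) → le }
  rres-lower f ω       = _ ≤ω-top

  rres-upper : ∀ f n {q} → 0 < n → fun f q ≤ω fin n → q ≤ω fun (rres f) (fin n)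
  rres-upper f n 0<n le = sup-upper {Below f n} proj₁ (_ , 0<n , le)

  rres-greatest : ∀ f → IsGreatest (rres f) (λ k → ∀ p → fun f (fun k p) ≤ω p)
  rres-greatest f k = mk⇔
    (λ k≤f p → ≤ω-trans (mono f (k≤f p)) (rres-lower f p))
    (λ h → ≤W-from-finite k (rres f) (below h))
    where
    below : (∀ p → fun f (fun k p) ≤ω p) → ∀ n → fun k (fin n) ≤ω fun (rres f) (fin n)
    below h zero    = ≤ω-reflexive (trans (strict k) (sym (strict (rres f))))
    below h (suc n) = rres-upper f (suc n) (s≤s z≤n) (h (fin (suc n)))

  Unlimited-rres : ∀ f → Unlimited f → Unlimited (rres f)
  Unlimited-rres f (f<ω , fω) = r<ω , unbounded⇒≡ω unb
    where
    r<ω : ∀ n → fun (rres f) (fin n) <ω ω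
    r<ω n = ≢ω⇒<ω-top λ e → ω≰fin
      (subst (_≤ω fin n) (trans (cong (fun f) e) fω) (rres-lower f (fin n)))
    unb : ∀ m → fin m ≤ω fun (rres f) ω
    unb m with <ω-top⇒fin (f<ω m)
    -- The argument is `suc k` because `rres-upper` needs a positive one and k may be 0.
    ... | k , e = ≤ω-trans
      (rres-upper f (suc k) (s≤s z≤n) (≤ω-trans (≤ω-reflexive e) (fin≤fin (NP.n≤1+n k))))
      (mono (rres f) (fin (suc k) ≤ω-top))

  Unlimited-rres⁻¹ : ∀ f → Unlimited (rres f) → Unlimited f
  Unlimited-rres⁻¹ f (r<ω , rω) = f<ω , fω
    where
    f<ω : ∀ n → fun f (fin n) <ω ω
    f<ω n with approx (rres f) n (subst (fin n ≤ω_) (sym rω) (fin n ≤ω-top))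
    ... | m , n≤rm = ≤ω-<ω-top (≤ω-trans (mono f n≤rm) (rres-lower f (fin m))) (fin<ω m)
    fω : fun f ω ≡ ω
    fω with finite? (fun f ω)
    ... | inj₂ e = e
    -- Then ω itself is an admissible q at `suc k`, so the residual is already infinite there.
    ... | inj₁ (k , e) = ⊥-elim (<ω⇒≱ω (r<ω (suc k))
      (rres-upper f (suc k) (s≤s z≤n) (≤ω-trans (≤ω-reflexive e) (fin≤fin (NP.n≤1+n k)))))

  rres-fin-< : ∀ f n {q} → 0 < n → fun (rres f) (fin n) ≡ fin q → fin n <ω fun f (fin (suc q))
  rres-fin-< f n 0<n e = ≰ω⇒>ω λ le → suc≰ω (subst (_ ≤ω_) e (rres-upper f n 0<n le))

  -- A finite q is certified as the greatest solution by failure at its successor; q = ω has no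
  -- successor to test. The two certificates have the shapes of `c15` and `c16`.
  rres-fin-≡ : ∀ f n {q} → fun f q ≤ω fin n → (∀ m → q ≡ fin m → fin n <ω fun f (fin (suc m))) →
               0 < n → fun (rres f) (fin n) ≡ q
  rres-fin-≡ f n {q} le suc> 0<n = ≤ω-antisym (upper (finite? q)) (rres-upper f n 0<n le)
    where
    upper : (∃ λ m → q ≡ fin m) ⊎ q ≡ ω → fun (rres f) (fin n) ≤ω q
    upper (inj₂ refl)       = _ ≤ω-top
    upper (inj₁ (m , refl)) = by-contradiction λ h → <ω⇒≱ω (suc> m refl)
      (≤ω-trans (mono f (≰ω⇒suc≤ω h)) (rres-lower f (fin n)))

  rres-ω-≤ : ∀ f {q} → fun f (fin (suc q)) ≡ ω → fun (rres f) ω ≤ω fin q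
  rres-ω-≤ f e = cont-lub (rres f) λ n → by-contradiction λ h → ω≰fin
    (subst (_≤ω fin n) e (≤ω-trans (mono f (≰ω⇒suc≤ω h)) (rres-lower f (fin n))))

  -- Were `f` at q + 1 below some n, the residual at n + 1, and hence at ω, would be at least q + 1.
  rres-ω-fin : ∀ f {q} → fun (rres f) ω ≡ fin q → fun f (fin (suc q)) ≡ ω
  rres-ω-fin f {q} e = unbounded⇒≡ω λ n → by-contradiction λ h →
    suc≰ω (subst (fin (suc q) ≤ω_) e (≤ω-trans
      (rres-upper f (suc n) (s≤s z≤n) (≤ω-trans (<ω⇒≤ω (≰ω⇒>ω h)) (fin≤fin (NP.n≤1+n n))))
      (mono (rres f) (fin (suc n) ≤ω-top))))

  rres-<⊕1 : ∀ f p {r} → fin 0 <ω p → p <ω ω → r <ω ω → fun (rres f) p ≡ r → p <ω fun f (r ⊕1)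
  rres-<⊕1 f (fin n) (fin<fin 0<n) _ (fin<ω q) e = rres-fin-< f n 0<n e

  -- id / f

  Above : TimeWarp → ℕ → ω̄ → Set
  Above f n q = fin n ≤ω fun f q

  lres : TimeWarp → TimeWarp
  lres f = extend (λ n → least (Above f n))
    (λ {m} {n} m≤n → least-antitone (Above f m) (Above f n) λ q → ≤ω-trans (fin≤fin m≤n))
    (≤0⇒≡0 (least-≤ (Above f 0) 0≤ω))

  -- The right-hand argument is finite: at ω the left side always holds, while `p ≤ω fun f ω` can
  -- fail, as for `⊥W`.
  lres-galois : ∀ f p m → (fun (lres f) p ≤ω fin m) ⇔ (p ≤ω fun f (fin m))
  lres-galois f p m = mk⇔ (to′ p) (from′ p)
    where
    to′ : ∀ p → fun (lres f) p ≤ω fin m → p ≤ω fun f (fin m)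
    to′ (fin n) le with finite? (least (Above f n))
    ... | inj₁ (k , e) = ≤ω-trans (least-∈ (Above f n) e) (mono f (subst (_≤ω fin m) e le))
    ... | inj₂ e       = ⊥-elim (ω≰fin (subst (_≤ω fin m) e le))
    to′ ω le = ≤ω-reflexive (sym (unbounded⇒≡ω λ n →
      to′ (fin n) (≤ω-trans (mono (lres f) (fin n ≤ω-top)) le)))
    from′ : ∀ p → p ≤ω fun f (fin m) → fun (lres f) p ≤ω fin m
    from′ (fin n) le = least-≤ (Above f n) le
    from′ ω       le = cont-lub (lres f) λ n →
      from′ (fin n) (≤ω-trans (fin n ≤ω-top) le)

  lres-greatest : ∀ f → IsGreatest (lres f) (λ k → ∀ p → fun k (fun f p) ≤ω p)
  lres-greatest f k = mk⇔
    (λ k≤f p → ≤ω-trans (k≤f (fun f p)) (lower p))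
    (λ h → ≤W-from-finite k (lres f) (below h))
    where
    lower : ∀ p → fun (lres f) (fun f p) ≤ω p
    lower (fin m) = from (lres-galois f _ m) ≤ω-refl
    lower ω       = _ ≤ω-top
    below : (∀ p → fun k (fun f p) ≤ω p) → ∀ n → fun k (fin n) ≤ω fun (lres f) (fin n)
    below h n with finite? (fun (lres f) (fin n))
    ... | inj₂ e = subst (fun k (fin n) ≤ω_) (sym e) (_ ≤ω-top)
    ... | inj₁ (q , e) = subst (fun k (fin n) ≤ω_) (sym e) (≤ω-trans
            (mono k (to (lres-galois f (fin n) q) (≤ω-reflexive e))) (h (fin q)))

  Unlimited-lres : ∀ f → Unlimited f → Unlimited (lres f)
  Unlimited-lres f (f<ω , fω) = l<ω , unbounded⇒≡ω unb
    where
    l<ω : ∀ n → fun (lres f) (fin n) <ω ω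
    l<ω n with approx f n (subst (fin n ≤ω_) (sym fω) (fin n ≤ω-top))
    ... | m , n≤fm = ≤ω-<ω-top (from (lres-galois f (fin n) m) n≤fm) (fin<ω m)
    unb : ∀ m → fin m ≤ω fun (lres f) ω
    unb m with <ω-top⇒fin (f<ω m)
    ... | k , e = <ω⇒≤ω (≰ω⇒>ω λ le → ω≰fin
          (subst (ω ≤ω_) e (to (lres-galois f ω m) le)))

  Unlimited-lres⁻¹ : ∀ f → Unlimited (lres f) → Unlimited f
  Unlimited-lres⁻¹ f (l<ω , lω) = f<ω , unbounded⇒≡ω unb
    where
    f<ω : ∀ n → fun f (fin n) <ω ω
    f<ω n = ≢ω⇒<ω-top λ e → ω≰fin (subst (_≤ω fin n) lω
      (from (lres-galois f ω n) (≤ω-reflexive (sym e))))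
    unb : ∀ n → fin n ≤ω fun f ω
    unb n with <ω-top⇒fin (l<ω n)
    ... | m , e = ≤ω-trans (to (lres-galois f (fin n) m) (≤ω-reflexive e)) (mono f (fin m ≤ω-top))

  lres-fin-≤ : ∀ f p {r} → r <ω ω → fun (lres f) p ≡ r → p ≤ω fun f r
  lres-fin-≤ f p (fin<ω q) e = to (lres-galois f p q) (≤ω-reflexive e)

  lres-⊖1-< : ∀ f p {r} → fin 0 <ω p → r <ω ω → fun (lres f) p ≡ r → fun f (r ⊖1) <ω p
  -- Truncation leaves 0 in place, so strictness and `0<p` give the bound.
  lres-⊖1-< f p 0<p (fin<ω zero)    e = subst (_<ω p) (sym (strict f)) 0<p
  lres-⊖1-< f p 0<p (fin<ω (suc q)) e = ≰ω⇒>ω λ le →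
    suc≰ω (subst (_≤ω fin q) e (from (lres-galois f p q) le))

  -- A finite p at or below `f ω` is already reached at some finite m, and the residual at p would
  -- then be at most m.
  lres-ω-< : ∀ f p {r} → p <ω ω → r ≡ ω → fun (lres f) p ≡ r → fun f r <ω p
  lres-ω-< f (fin n) _ refl e = ≰ω⇒>ω λ le → let m , n≤fm = approx f n le in
    ω≰fin (subst (_≤ω fin m) e (from (lres-galois f (fin n) m) n≤fm))

  -- The hypotheses have the shapes of `c19`, `c20` and `c21`: a finite q is least if it attains n
  -- and its predecessor does not, and q = ω means that n is never attained.
  lres-fin-≡ : ∀ f n {q} → (q <ω ω → fin n ≤ω fun f q) → (q <ω ω → fun f (q ⊖1) <ω fin n) →
               (q ≡ ω → fun f q <ω fin n) → fun (lres f) (fin n) ≡ q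
  lres-fin-≡ f n {fin q} le pred< _ = ≤ω-antisym
    (from (lres-galois f (fin n) q) (le (fin<ω q))) (lower q (pred< (fin<ω q)))
    where
    lower : ∀ q → fun f (fin q ⊖1) <ω fin n → fin q ≤ω fun (lres f) (fin n)
    lower zero    _  = 0≤ω
    lower (suc q) lt = ≰ω⇒suc≤ω λ l → <ω⇒≱ω lt (to (lres-galois f (fin n) q) l)
  lres-fin-≡ f n {ω} _ _ top< = unbounded⇒≡ω λ m → <ω⇒≤ω (≰ω⇒>ω λ l →
    <ω⇒≱ω (top< refl) (≤ω-trans (to (lres-galois f (fin n) m) l) (mono f (fin m ≤ω-top))))

  -- Interpretation of terms as a function

  interp : Assignment → Term → TimeWarp
  interp ρ (var x) = ρ x
  interp ρ (t · u) = interp ρ t ∘W interp ρ u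
  interp ρ (t ᵒ)   = ores (interp ρ t)
  interp ρ (t ˡ)   = lres (interp ρ t)
  interp ρ (t ʳ)   = rres (interp ρ t)
  interp ρ idT     = idW
  interp ρ ⊥T      = ⊥W

  -- Existence is needed to refute validity from a diagram; `interp-unique` serves the converse,
  -- moving a given refutation to `interp`.
  interp-correct : ∀ ρ t → ⟦ t ⟧ ρ ≈ interp ρ t
  interp-correct ρ (var x) = ⟦var⟧ λ p → refl
  interp-correct ρ (t · u) = ⟦·⟧ (interp-correct ρ t) (interp-correct ρ u) λ p → refl
  interp-correct ρ (t ᵒ)   = ⟦ᵒ⟧ (interp-correct ρ t) (ores-greatest (interp ρ t))
  interp-correct ρ (t ˡ)   = ⟦ˡ⟧ (interp-correct ρ t) (lres-greatest (interp ρ t))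
  interp-correct ρ (t ʳ)   = ⟦ʳ⟧ (interp-correct ρ t) (rres-greatest (interp ρ t))
  interp-correct ρ idT     = ⟦id⟧ λ p → refl
  interp-correct ρ ⊥T      = ⟦⊥⟧ λ p → refl

  interp-unique : ∀ {ρ t f} → ⟦ t ⟧ ρ ≈ f → ∀ p → fun f p ≡ fun (interp ρ t) p
  interp-unique (⟦var⟧ h) = h
  interp-unique {ρ} {t · u} (⟦·⟧ {h = h} T U f≡gh) p =
    trans (f≡gh p) (trans (interp-unique T (fun h p)) (cong (fun (interp ρ t)) (interp-unique U p)))
  interp-unique {ρ} {t ᵒ} {f} (⟦ᵒ⟧ T G) =
    IsGreatest-unique f (ores (interp ρ t)) G (ores-greatest (interp ρ t))
      (λ k h p → subst (topF (fun k p) ≤ω_) (interp-unique T p) (h p))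
      (λ k h p → subst (topF (fun k p) ≤ω_) (sym (interp-unique T p)) (h p))
  interp-unique {ρ} {t ˡ} {f} (⟦ˡ⟧ T G) =
    IsGreatest-unique f (lres (interp ρ t)) G (lres-greatest (interp ρ t))
      (λ k h p → subst (λ q → fun k q ≤ω p) (interp-unique T p) (h p))
      (λ k h p → subst (λ q → fun k q ≤ω p) (sym (interp-unique T p)) (h p))
  interp-unique {ρ} {t ʳ} {f} (⟦ʳ⟧ T G) =
    IsGreatest-unique f (rres (interp ρ t)) G (rres-greatest (interp ρ t))
      (λ k h p → subst (_≤ω p) (interp-unique T (fun k p)) (h p))
      (λ k h p → subst (_≤ω p) (sym (interp-unique T (fun k p))) (h p))
  interp-unique (⟦id⟧ h) = h
  interp-unique (⟦⊥⟧ h)  = h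

  -- Valuations of samples

  val : Assignment → ω̄ → Sample → ω̄
  val ρ p (tvar _)  = p
  val ρ p (t [ α ]) = fun (interp ρ t) (val ρ p α)
  val ρ p (s α)     = val ρ p α ⊕1
  val ρ p (pr α)    = val ρ p α ⊖1
  val ρ p (last t)  = lastW (interp ρ t)

  val-isDiagram : ∀ Δ ρ p → IsDiagram Δ (val ρ p)
  val-isDiagram Δ ρ p = record
    { c1  = λ t α β _ _ _ _ → mono (I t)
    ; c2  = λ t α _ _ e → trans (cong (fun (I t)) e) (strict (I t))
    ; c3  = λ α _ _ → refl
    ; c4  = λ α _ _ → refl
    ; c5  = λ t α _ _ _ _ → lastW-≤⇔ (I t) (val ρ p α)
    ; c6  = λ t _ _ e → trans (cong (fun (I t)) e) (proj₂ (lastW≡ω⇒Unlimited (I t) e))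
    ; c7  = λ α _ _ → refl
    ; c8  = λ α _ _ → ≤0⇒≡0 (from (lastW-≤⇔ ⊥W (fin 0)) refl)
    ; c9  = λ t u α _ _ → refl
    ; c10 = λ t u _ _ _ _ e →
        let Ut , Uu = Unlimited-∘⁻¹ (I t) (I u) (lastW≡ω⇒Unlimited (I (t · u)) e)
        in Unlimited⇒lastW≡ω (I t) Ut , Unlimited⇒lastW≡ω (I u) Uu
    ; c11 = λ t α _ → ores-0-or-ω (I t) (val ρ p α)
    ; c12 = λ t α _ _ _ → ores-ω⇔ (I t)
    ; c13 = λ t _ → ≢ω⇒<ω-top (¬Unlimited-ores (I t) ∘ lastW≡ω⇒Unlimited (I (t ᵒ)))
    ; c14 = λ t α _ _ _ o<ω → ores-last (I t) o<ω
    ; c15 = λ t α _ _ → rres-lower (I t) (val ρ p α)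
    ; c16 = λ t α _ _ _ 0<p p<ω r<ω → rres-<⊕1 (I t) (val ρ p α) 0<p p<ω r<ω refl
    ; c17 = λ t _ _ _ e →
        Unlimited⇒lastW≡ω (I t) (Unlimited-rres⁻¹ (I t) (lastW≡ω⇒Unlimited (I (t ʳ)) e))
    -- By `fun-lastW` the value at `last` is the value at ω, so `c18` and `c23` become statements
    -- about residuals at ω.
    ; c18 = λ t _ _ r<ω → rres-ω-⊕1 (I t) r<ω (sym (fun-lastW (I (t ʳ))))
    ; c19 = λ t α _ _ _ l<ω → lres-fin-≤ (I t) (val ρ p α) l<ω refl
    ; c20 = λ t α _ _ _ 0<p _ l<ω → lres-⊖1-< (I t) (val ρ p α) 0<p l<ω refl
    ; c21 = λ t α _ _ _ p<ω e → lres-ω-< (I t) (val ρ p α) p<ω e refl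
    ; c22 = λ t _ _ _ e →
        Unlimited⇒lastW≡ω (I t) (Unlimited-lres⁻¹ (I t) (lastW≡ω⇒Unlimited (I (t ˡ)) e))
    ; c23 = λ t _ _ l<ω → ω≤⇒≡ω (lres-fin-≤ (I t) ω l<ω (sym (fun-lastW (I (t ˡ)))))
    }
    where
    I = interp ρ
    ores-ω⇔ : ∀ f {p} → p <ω ω → (fun (ores f) p ≡ ω) ⇔ (fun f p ≡ ω)
    ores-ω⇔ f (fin<ω n) = ores-fin-ω⇔ f n
    ores-last : ∀ f {p} → fun (ores f) (lastW (ores f)) <ω ω → p <ω ω → fun f p <ω ω
    ores-last f o<ω (fin<ω n) = ≢ω⇒<ω-top λ e → <ω⇒≱ω o<ω
      (subst (_≤ω fun (ores f) (lastW (ores f))) (ores-fin-ω f n e)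
        (subst (fun (ores f) (fin n) ≤ω_) (sym (fun-lastW (ores f)))
          (mono (ores f) (fin n ≤ω-top))))
    rres-ω-⊕1 : ∀ f {r} → r <ω ω → fun (rres f) ω ≡ r → fun f (r ⊕1) ≡ ω
    rres-ω-⊕1 f (fin<ω q) e = rres-ω-fin f e

  -- Finiteness of saturations

  -- Steps may leave `S` through `Base`. Treating the argument as an exit makes induction on the
  -- term possible: for t ʳ the recursive calls have arguments built from `(t ʳ) [ α ]`, the very
  -- sample being closed.
  ClosedUpTo : (Sample → Set) → List Sample → Set
  ClosedUpTo Base S = ∀ {β γ} → β ∈ S → β ↝ γ → γ ∈ S ⊎ Base γ

  ∈∷-++⁻ : ∀ {A : Set} {x y : A} xs {ys} → x ∈ y ∷ (xs ++ ys) → x ≡ y ⊎ (x ∈ xs ⊎ x ∈ ys)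
  ∈∷-++⁻ xs (here e)  = inj₁ e
  ∈∷-++⁻ xs (there i) = inj₂ (∈-++⁻ xs i)

  mutual
    -- The exit `t [ last t ]` of `reach-mod-last` is closed by a second run with argument `last t`:
    -- that run starts at this sample, and no step leaves `last t`.
    reach : ∀ t α → ∃ λ S → (t [ α ]) ∈ S × ClosedUpTo (_≡ α) S
    reach t α with reach-mod-last t α | reach-mod-last t (last t)
    ... | S , tα∈S , closed | S′ , tl∈S′ , closed′ =
      last t ∷ (S ++ S′) , there (∈-++⁺ˡ tα∈S) , step
      where
      inS : ∀ {γ} → γ ∈ S → γ ∈ last t ∷ (S ++ S′)
      inS = there ∘ ∈-++⁺ˡ
      inS′ : ∀ {γ} → γ ∈ S′ → γ ∈ last t ∷ (S ++ S′)
      inS′ = there ∘ ∈-++⁺ʳ S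
      step : ClosedUpTo (_≡ α) (last t ∷ (S ++ S′))
      step i r with ∈∷-++⁻ S i
      step i () | inj₁ refl
      step i r  | inj₂ (inj₁ j) with closed j r
      ... | inj₁ k           = inj₁ (inS k)
      ... | inj₂ (inj₁ e)    = inj₂ e
      ... | inj₂ (inj₂ refl) = inj₁ (inS′ tl∈S′)
      step i r  | inj₂ (inj₂ j) with closed′ j r
      ... | inj₁ k           = inj₁ (inS′ k)
      ... | inj₂ (inj₁ refl) = inj₁ (here refl)
      ... | inj₂ (inj₂ refl) = inj₁ (inS′ tl∈S′)

    reach-mod-last : ∀ t α → ∃ λ S → (t [ α ]) ∈ S × ClosedUpTo (λ γ → γ ≡ α ⊎ γ ≡ (t [ last t ])) S
    reach-mod-last (var x) α = _ ∷ [] , here refl , λ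
      { (here refl) (app↝ _ _)  → inj₂ (inj₁ refl)
      ; (here refl) (last↝ _ _) → inj₂ (inj₂ refl) }
    reach-mod-last idT α = _ ∷ [] , here refl , λ
      { (here refl) (app↝ _ _)  → inj₂ (inj₁ refl)
      ; (here refl) (last↝ _ _) → inj₂ (inj₂ refl) }
    reach-mod-last ⊥T α = _ ∷ [] , here refl , λ
      { (here refl) (app↝ _ _)  → inj₂ (inj₁ refl)
      ; (here refl) (last↝ _ _) → inj₂ (inj₂ refl) }
    reach-mod-last (t ᵒ) α with reach t α
    ... | S , tα∈S , closed = ((t ᵒ) [ α ]) ∷ S , here refl , step
      where
      step : ClosedUpTo (λ γ → γ ≡ α ⊎ γ ≡ ((t ᵒ) [ last (t ᵒ) ])) (((t ᵒ) [ α ]) ∷ S)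
      step (here refl) (app↝ _ _)  = inj₂ (inj₁ refl)
      step (here refl) (ᵒ↝ _ _)    = inj₁ (there tα∈S)
      step (here refl) (last↝ _ _) = inj₂ (inj₂ refl)
      step (there i) r with closed i r
      ... | inj₁ j = inj₁ (there j)
      ... | inj₂ e = inj₂ (inj₁ e)
    reach-mod-last (t · u) α with reach t (u [ α ]) | reach u α
    ... | S , tuα∈S , closed | S′ , uα∈S′ , closed′ =
      ((t · u) [ α ]) ∷ (S ++ S′) , here refl , step
      where
      step : ClosedUpTo (λ γ → γ ≡ α ⊎ γ ≡ ((t · u) [ last (t · u) ])) (((t · u) [ α ]) ∷ (S ++ S′))
      step i r with ∈∷-++⁻ S i
      step i (app↝ _ _)  | inj₁ refl = inj₂ (inj₁ refl)
      step i (·↝ _ _ _)  | inj₁ refl = inj₁ (there (∈-++⁺ˡ tuα∈S))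
      step i (last↝ _ _) | inj₁ refl = inj₂ (inj₂ refl)
      step i r | inj₂ (inj₁ j) with closed j r
      ... | inj₁ k    = inj₁ (there (∈-++⁺ˡ k))
      ... | inj₂ refl = inj₁ (there (∈-++⁺ʳ S uα∈S′))
      step i r | inj₂ (inj₂ j) with closed′ j r
      ... | inj₁ k = inj₁ (there (∈-++⁺ʳ S k))
      ... | inj₂ e = inj₂ (inj₁ e)
    reach-mod-last (t ʳ) α with reach t ((t ʳ) [ α ]) | reach t (s ((t ʳ) [ α ]))
    ... | S , t∈S , closed | S′ , t∈S′ , closed′ = T , here refl , step
      where
      -- The first two entries are the exits of the two recursive runs, which thereby become
      -- members.
      T = ((t ʳ) [ α ]) ∷ s ((t ʳ) [ α ]) ∷ (S ++ S′)
      step : ClosedUpTo (λ γ → γ ≡ α ⊎ γ ≡ ((t ʳ) [ last (t ʳ) ])) T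
      step (here refl) (app↝ _ _)  = inj₂ (inj₁ refl)
      step (here refl) (ʳ↝₁ _ _)   = inj₁ (there (there (∈-++⁺ˡ t∈S)))
      step (here refl) (ʳ↝₂ _ _)   = inj₁ (there (there (∈-++⁺ʳ S t∈S′)))
      step (here refl) (last↝ _ _) = inj₂ (inj₂ refl)
      step (there i) r with ∈∷-++⁻ S i
      step (there i) (s↝ _) | inj₁ refl = inj₁ (here refl)
      step (there i) r | inj₂ (inj₁ j) with closed j r
      ... | inj₁ k    = inj₁ (there (there (∈-++⁺ˡ k)))
      ... | inj₂ refl = inj₁ (here refl)
      step (there i) r | inj₂ (inj₂ j) with closed′ j r
      ... | inj₁ k    = inj₁ (there (there (∈-++⁺ʳ S k)))
      ... | inj₂ refl = inj₁ (there (here refl))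
    reach-mod-last (t ˡ) α with reach t ((t ˡ) [ α ]) | reach t (pr ((t ˡ) [ α ]))
    ... | S , t∈S , closed | S′ , t∈S′ , closed′ = T , here refl , step
      where
      T = ((t ˡ) [ α ]) ∷ pr ((t ˡ) [ α ]) ∷ (S ++ S′)
      step : ClosedUpTo (λ γ → γ ≡ α ⊎ γ ≡ ((t ˡ) [ last (t ˡ) ])) T
      step (here refl) (app↝ _ _)  = inj₂ (inj₁ refl)
      step (here refl) (ˡ↝₁ _ _)   = inj₁ (there (there (∈-++⁺ˡ t∈S)))
      step (here refl) (ˡ↝₂ _ _)   = inj₁ (there (there (∈-++⁺ʳ S t∈S′)))
      step (here refl) (last↝ _ _) = inj₂ (inj₂ refl)
      step (there i) r with ∈∷-++⁻ S i
      step (there i) (p↝ _) | inj₁ refl = inj₁ (here refl)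
      step (there i) r | inj₂ (inj₁ j) with closed j r
      ... | inj₁ k    = inj₁ (there (there (∈-++⁺ˡ k)))
      ... | inj₂ refl = inj₁ (here refl)
      step (there i) r | inj₂ (inj₂ j) with closed′ j r
      ... | inj₁ k    = inj₁ (there (there (∈-++⁺ʳ S k)))
      ... | inj₂ refl = inj₁ (there (here refl))

  -- An enclosing list suffices for bounding values. All runs share the exit `tvar κ`, from which no
  -- step starts.
  saturation-finite : ∀ {n} (ts : Fin n → Term) κ →
    ∃ λ S → ∀ {β} → Saturation (InitSamples ts κ) β → β ∈ S
  saturation-finite {n} ts κ = tvar κ ∷ concat (tabulate S) ,
    λ { (_ , (i , refl) , r) → run i (inj₁ (proj₁ (proj₂ (R i)))) r }
    where
    R = λ i → reach (ts i) (tvar κ)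
    S : Fin n → List Sample
    S i = proj₁ (R i)
    run : ∀ i {α β} → α ∈ S i ⊎ α ≡ tvar κ → α ↝* β → β ∈ tvar κ ∷ concat (tabulate S)
    run i (inj₁ m)    ε       = there (∈-concat⁺′ m (∈-tabulate⁺ i))
    run i (inj₂ refl) ε       = here refl
    run i (inj₁ m)    (r ◅ q) = run i (proj₂ (proj₂ (R i)) m r) q
    run i (inj₂ refl) (() ◅ q)

  bounded-on-list : ∀ (δ : Sample → ω̄) S → ∃ λ N → ∀ {β n} → β ∈ S → δ β ≡ fin n → n ≤ N
  bounded-on-list δ [] = 0 , λ ()
  bounded-on-list δ (α ∷ S) with bounded-on-list δ S | finite? (δ α)
  ... | N , h | inj₁ (m , e) = m N.⊔ N , λ
    { (here refl) e′ → fin≤⁻¹ (≤ω-trans (≤ω-reflexive (trans (sym e′) e)) (fin≤fin (NP.m≤m⊔n m N)))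
    ; (there i)   e′ → NP.≤-trans (h i e′) (NP.m≤n⊔m m N) }
  ... | N , h | inj₂ e = N , λ
    { (here refl) e′ → ⊥-elim (ω≰fin (≤ω-reflexive (trans (sym e) e′)))
    ; (there i)   e′ → h i e′ }

  -- Realising a diagram by time warps

  module Realisation
    (Δ : Sample → Set) (saturated : ∀ {α β} → Δ α → α ↝ β → Δ β)
    (δ : Sample → ω̄) (diagram : IsDiagram Δ δ)
    (N : ℕ) (bounded : ∀ {β n} → Δ β → δ β ≡ fin n → n ≤ N)
    where
    open IsDiagram diagram

    arg : ∀ {t α} → Δ (t [ α ]) → Δ α
    arg d = saturated d (app↝ _ _)

    at-last : ∀ {t α} → Δ (t [ α ]) → Δ (t [ last t ])
    at-last d = saturated d (last↝ _ _)

    last-≤⇔ : ∀ {t α} → Δ (t [ α ]) → (δ (last t) ≤ω δ α) ⇔ (δ (t [ α ]) ≡ δ (t [ last t ]))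
    last-≤⇔ d = c5 _ _ d (arg d) (arg (at-last d)) (at-last d)

    ≤-at-last : ∀ {t α} → Δ (t [ α ]) → δ (t [ α ]) ≤ω δ (t [ last t ])
    ≤-at-last {t} {α} d with em {δ (last t) ≤ω δ α}
    ... | yes le = ≤ω-reflexive (to (last-≤⇔ d) le)
    ... | no  h  = c1 _ _ _ d (at-last d) (arg d) (arg (at-last d)) (<ω⇒≤ω (≰ω⇒>ω h))

    -- The second component is what lets the residuals of f be evaluated at ω.
    Realises : Term → TimeWarp → Set
    Realises t f = (∀ {α} → Δ (t [ α ]) → fun f (δ α) ≡ δ (t [ α ])) ×
                   (Δ (t [ last t ]) → δ (last t) ≡ ω → Unlimited f)

    -- By `c5`, a sample with argument ω takes the value of `t [ last t ]`. If `last t` is finite,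
    -- `at-fin` there gives one inequality for `f ω` and `at-ω` the other; if it is ω, both sides
    -- are ω by `unlimited` and `c6`.
    realises : ∀ t f →
      (∀ {α} n → Δ (t [ α ]) → δ α ≡ fin n → fun f (fin n) ≡ δ (t [ α ])) →
      (Δ (t [ last t ]) → δ (last t) ≡ ω → Unlimited f) →
      (∀ {α m} → Δ (t [ α ]) → δ α ≡ ω → δ (last t) ≡ fin m → fun f ω ≤ω δ (t [ last t ])) →
      Realises t f
    realises t f at-fin unlimited at-ω = at , unlimited
      where
      at : ∀ {α} → Δ (t [ α ]) → fun f (δ α) ≡ δ (t [ α ])
      at {α} d with finite? (δ α)
      ... | inj₁ (n , e) = trans (cong (fun f) e) (at-fin n d e)
      ... | inj₂ e = trans (cong (fun f) e) (trans (at-top (finite? (δ (last t)))) (sym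
              (to (last-≤⇔ d) (subst (δ (last t) ≤ω_) (sym e) (_ ≤ω-top)))))
        where
        at-top : (∃ λ m → δ (last t) ≡ fin m) ⊎ δ (last t) ≡ ω → fun f ω ≡ δ (t [ last t ])
        at-top (inj₁ (m , e′)) = ≤ω-antisym (at-ω d e e′)
          (subst (_≤ω fun f ω) (at-fin m (at-last d) e′) (mono f (fin m ≤ω-top)))
        at-top (inj₂ e′) = trans (proj₂ (unlimited (at-last d) e′))
          (sym (c6 t (at-last d) (arg (at-last d)) e′))

    -- The second summand makes the warp unlimited when last (var x) is ω; beyond N
    -- it interferes with no sample.
    Below-var : ℕ → ℕ → Set
    Below-var x n = (∃ λ α → Δ (var x [ α ]) × δ α ≤ω fin n) ⊎ (N < n × δ (last (var x)) ≡ ω)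

    value : ∀ x {n} → Below-var x n → ω̄
    value x     (inj₁ (α , _)) = δ (var x [ α ])
    value x {n} (inj₂ _)       = fin n

    -- This is the least monotone map above the values prescribed at finite arguments, with an
    -- identity tail past N if `last (var x)` is ω.
    F-var : ℕ → ℕ → ω̄
    F-var x n = sup (value x {n})

    F-var-mono : ∀ x {m n} → m ≤ n → F-var x m ≤ω F-var x n
    F-var-mono x {m} {n} m≤n = sup-mono (value x {m}) (value x {n}) λ
      { (inj₁ (α , d , le)) → inj₁ (α , d , ≤ω-trans le (fin≤fin m≤n)) , ≤ω-refl
      ; (inj₂ (N<m , e))    → inj₂ (NP.≤-trans N<m m≤n , e) , fin≤fin m≤n }

    F-var-zero : ∀ x → F-var x 0 ≡ fin 0
    F-var-zero x = ≤0⇒≡0 (sup-lub (value x {0}) λ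
      { (inj₁ (α , d , le)) → ≤ω-reflexive (c2 _ _ d (arg d) (≤0⇒≡0 le))
      ; (inj₂ (() , _)) })

    assignment : Assignment
    assignment x = extend (F-var x) (F-var-mono x) (F-var-zero x)

    realises-var : ∀ x → Realises (var x) (assignment x)
    realises-var x = realises (var x) (assignment x) at-fin (λ d e → fin-at d e , ω-at e) at-ω
      where
      at-fin : ∀ {α} n → Δ (var x [ α ]) → δ α ≡ fin n → F-var x n ≡ δ (var x [ α ])
      at-fin {α} n d e = ≤ω-antisym
        (sup-lub (value x {n}) λ
          { (inj₁ (β , d′ , le)) →
              c1 _ _ _ d′ d (arg d′) (arg d) (≤ω-trans le (≤ω-reflexive (sym e)))
          ; (inj₂ (N<n , _)) → ⊥-elim (NP.<⇒≱ N<n (bounded (arg d) e)) })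
        (sup-upper (value x {n}) (inj₁ (α , d , ≤ω-reflexive e)))
      fin-at : Δ (var x [ last (var x) ]) → δ (last (var x)) ≡ ω → ∀ n → F-var x n <ω ω
      -- Prescribed finite values are at most N, and the tail contributes at most n.
      fin-at dl l≡ω n = ≤ω-<ω-top {q = fin (N N.⊔ n)}
        (sup-lub (value x {n}) λ
          { (inj₁ (α , d , le)) → small d le (finite? (δ (var x [ α ])))
          ; (inj₂ _) → fin≤fin (NP.m≤n⊔m N n) }) (fin<ω _)
        where
        small : ∀ {α} → Δ (var x [ α ]) → δ α ≤ω fin n →
                (∃ λ k → δ (var x [ α ]) ≡ fin k) ⊎ δ (var x [ α ]) ≡ ω →
                δ (var x [ α ]) ≤ω fin (N N.⊔ n)
        small d le (inj₁ (k , e)) = ≤ω-trans (≤ω-reflexive e)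
          (fin≤fin (NP.≤-trans (bounded d e) (NP.m≤m⊔n N n)))
        -- By `c6` the value ω is that of `var x [ last (var x) ]`, so `c5` would put ω below the
        -- finite argument.
        small d le (inj₂ e) = ⊥-elim (ω≰fin (subst (_≤ω fin n) l≡ω (≤ω-trans
          (from (last-≤⇔ d) (trans e (sym (c6 _ dl (arg dl) l≡ω)))) le)))
      ω-at : δ (last (var x)) ≡ ω → sup (F-var x) ≡ ω
      ω-at e = unbounded⇒≡ω λ n → ≤ω-trans
        (≤ω-trans (fin≤fin (NP.m≤n⊔m (suc N) n))
          (sup-upper (value x {suc N N.⊔ n}) (inj₂ (NP.m≤m⊔n (suc N) n , e))))
        (sup-upper (F-var x) (suc N N.⊔ n))
      at-ω : ∀ {α m} → Δ (var x [ α ]) → δ α ≡ ω → δ (last (var x)) ≡ fin m →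
             sup (F-var x) ≤ω δ (var x [ last (var x) ])
      at-ω _ _ e = sup-lub (F-var x) λ n → sup-lub (value x {n}) λ
        { (inj₁ (α , d , _)) → ≤-at-last d
        ; (inj₂ (_ , e′)) → ⊥-elim (ω≰fin (≤ω-reflexive (trans (sym e′) e))) }

    realises-· : ∀ t u f g → Realises t f → Realises u g → Realises (t · u) (f ∘W g)
    realises-· t u f g (at-f , Uf) (at-g , Ug) = at , unlimited
      where
      at : ∀ {α} → Δ ((t · u) [ α ]) → fun f (fun g (δ α)) ≡ δ ((t · u) [ α ])
      at d = trans (cong (fun f) (at-g (arg d′))) (trans (at-f d′) (sym (c9 _ _ _ d d′)))
        where d′ = saturated d (·↝ _ _ _)
      unlimited : Δ ((t · u) [ last (t · u) ]) → δ (last (t · u)) ≡ ω → Unlimited (f ∘W g)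
      unlimited d e = Unlimited-∘ f g (Uf dt (proj₁ lasts)) (Ug du (proj₂ lasts))
        where
        d′ = saturated d (·↝ _ _ _)
        dt = at-last d′
        du = at-last (arg d′)
        lasts = c10 t u d (arg d) (arg dt) (arg du) e

    realises-ᵒ : ∀ t f → Realises t f → Realises (t ᵒ) (ores f)
    realises-ᵒ t f (at-f , Uf) = realises (t ᵒ) (ores f) at-fin
      (λ d e → ⊥-elim (<ω-top⇒≢ω (c13 t (arg d)) e)) at-ω
      where
      at-fin : ∀ {α} n → Δ ((t ᵒ) [ α ]) → δ α ≡ fin n → fun (ores f) (fin n) ≡ δ ((t ᵒ) [ α ])
      at-fin {α} n d e with c11 t α d
      ... | inj₂ o≡ω = trans (ores-fin-ω f n (trans (trans (cong (fun f) (sym e)) (at-f d′))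
              (to (c12 t α d d′ (arg d) (fin⇒<ω-top e)) o≡ω))) (sym o≡ω)
        where d′ = saturated d (ᵒ↝ _ _)
      ... | inj₁ o≡0 = trans (ores-fin-0 f n λ fn≡ω → 0≢ω (trans (sym o≡0)
              (from (c12 t α d d′ (arg d) (fin⇒<ω-top e))
                (trans (sym (at-f d′)) (trans (cong (fun f) e) fn≡ω))))) (sym o≡0)
        where d′ = saturated d (ᵒ↝ _ _)
      at-ω : ∀ {α m} → Δ ((t ᵒ) [ α ]) → δ α ≡ ω → δ (last (t ᵒ)) ≡ fin m →
             fun (ores f) ω ≤ω δ ((t ᵒ) [ last (t ᵒ) ])
      at-ω {α} d α≡ω _ with c11 t (last (t ᵒ)) (at-last d)
      ... | inj₂ o≡ω = subst (fun (ores f) ω ≤ω_) (sym o≡ω) (_ ≤ω-top)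
      -- The residual vanishes at ω only if f is finite at every finite argument, attained by a
      -- sample or not: `Unlimited` gives this if `last t` is ω, and otherwise `c14` makes even
      -- `f ω` finite.
      ... | inj₁ o≡0 = subst (fun (ores f) ω ≤ω_) (sym o≡0) (cont-lub (ores f) λ n →
              ≤ω-reflexive (ores-fin-0 f n (<ω-top⇒≢ω (f<ω n (finite? (δ (last t)))))))
        where
        d′ = saturated d (ᵒ↝ _ _)
        fω≡ : fun f ω ≡ δ (t [ last t ])
        fω≡ = trans (cong (fun f) (sym α≡ω)) (trans (at-f d′)
          (to (last-≤⇔ d′) (subst (δ (last t) ≤ω_) (sym α≡ω) (_ ≤ω-top))))
        f<ω : ∀ n → (∃ λ m → δ (last t) ≡ fin m) ⊎ δ (last t) ≡ ω → fun f (fin n) <ω ω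
        f<ω n (inj₂ e) = proj₁ (Uf (at-last d′) e) n
        f<ω n (inj₁ (m , e)) = ≤ω-<ω-top (mono f (fin n ≤ω-top)) (subst (_<ω ω) (sym fω≡)
          (c14 t (last t) (at-last d′) (at-last d) (arg (at-last d′))
            (fin⇒<ω-top o≡0) (fin⇒<ω-top e)))

    realises-ʳ : ∀ t f → Realises t f → Realises (t ʳ) (rres f)
    realises-ʳ t f (at-f , Uf) = realises (t ʳ) (rres f) at-fin unlimited at-ω
      where
      at-suc : ∀ {α q} → Δ ((t ʳ) [ α ]) → δ ((t ʳ) [ α ]) ≡ fin q →
               fun f (fin (suc q)) ≡ δ (t [ s ((t ʳ) [ α ]) ])
      at-suc d e = trans (cong (fun f) (sym (trans (c4 _ (arg d′) d) (cong _⊕1 e)))) (at-f d′)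
        where d′ = saturated d (ʳ↝₂ _ _)
      at-fin : ∀ {α} n → Δ ((t ʳ) [ α ]) → δ α ≡ fin n → fun (rres f) (fin n) ≡ δ ((t ʳ) [ α ])
      -- `c16` speaks of positive arguments only, so 0 is settled by strictness and `c2`.
      at-fin zero d e = trans (strict (rres f)) (sym (c2 _ _ d (arg d) e))
      at-fin {α} (suc n) d e = rres-fin-≡ f (suc n)
        (subst (_≤ω fin (suc n)) (sym (at-f d₁)) (subst (δ (t [ (t ʳ) [ α ] ]) ≤ω_) e
          (c15 t α d₁ (arg d))))
        (λ m e′ → subst (_<ω fun f (fin (suc m))) e (subst (δ α <ω_) (sym (at-suc d e′))
          (c16 t α d (arg d) d₂ (subst (fin 0 <ω_) (sym e) (fin<fin (s≤s z≤n)))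
            (fin⇒<ω-top e) (fin⇒<ω-top e′))))
        (s≤s z≤n)
        where
        d₁ = saturated d (ʳ↝₁ _ _)
        d₂ = saturated d (ʳ↝₂ _ _)
      unlimited : Δ ((t ʳ) [ last (t ʳ) ]) → δ (last (t ʳ)) ≡ ω → Unlimited (rres f)
      unlimited d e = Unlimited-rres f (Uf dt (c17 t d (arg d) (arg dt) e))
        where dt = at-last (saturated d (ʳ↝₁ _ _))
      at-ω : ∀ {α m} → Δ ((t ʳ) [ α ]) → δ α ≡ ω → δ (last (t ʳ)) ≡ fin m →
             fun (rres f) ω ≤ω δ ((t ʳ) [ last (t ʳ) ])
      at-ω d _ _ with finite? (δ ((t ʳ) [ last (t ʳ) ]))
      ... | inj₂ e = subst (fun (rres f) ω ≤ω_) (sym e) (_ ≤ω-top)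
      -- `c18` makes f infinite at q + 1, so no finite argument pushes the residual past q.
      ... | inj₁ (q , e) = subst (fun (rres f) ω ≤ω_) (sym e) (rres-ω-≤ f
              (trans (at-suc (at-last d) e)
                (c18 t (at-last d) (saturated (at-last d) (ʳ↝₂ _ _)) (fin⇒<ω-top e))))

    realises-ˡ : ∀ t f → Realises t f → Realises (t ˡ) (lres f)
    realises-ˡ t f (at-f , Uf) = realises (t ˡ) (lres f) at-fin unlimited at-ω
      where
      at-fin : ∀ {α} n → Δ ((t ˡ) [ α ]) → δ α ≡ fin n → fun (lres f) (fin n) ≡ δ ((t ˡ) [ α ])
      at-fin zero d e = trans (strict (lres f)) (sym (c2 _ _ d (arg d) e))
      at-fin {α} (suc n) d e = lres-fin-≡ f (suc n)
        (λ l<ω → subst (_≤ω fun f l) e (subst (δ α ≤ω_) (sym (at-f d₁))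
          (c19 t α d₁ d (arg d) l<ω)))
        (λ l<ω → subst (fun f (l ⊖1) <ω_) e (subst (_<ω δ α) (sym at-pred)
          (c20 t α d (arg d) d₂ (subst (fin 0 <ω_) (sym e) (fin<fin (s≤s z≤n)))
            (fin⇒<ω-top e) l<ω)))
        (λ l≡ω → subst (fun f l <ω_) e (subst (_<ω δ α) (sym (at-f d₁))
          (c21 t α d₁ d (arg d) (fin⇒<ω-top e) l≡ω)))
        where
        l = δ ((t ˡ) [ α ])
        d₁ = saturated d (ˡ↝₁ _ _)
        d₂ = saturated d (ˡ↝₂ _ _)
        at-pred : fun f (l ⊖1) ≡ δ (t [ pr ((t ˡ) [ α ]) ])
        at-pred = trans (cong (fun f) (sym (c3 _ (arg d₂) d))) (at-f d₂)
      unlimited : Δ ((t ˡ) [ last (t ˡ) ]) → δ (last (t ˡ)) ≡ ω → Unlimited (lres f)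
      unlimited d e = Unlimited-lres f (Uf dt (c22 t d (arg d) (arg dt) e))
        where dt = at-last (saturated d (ˡ↝₁ _ _))
      at-ω : ∀ {α m} → Δ ((t ˡ) [ α ]) → δ α ≡ ω → δ (last (t ˡ)) ≡ fin m →
             fun (lres f) ω ≤ω δ ((t ˡ) [ last (t ˡ) ])
      at-ω d _ _ with finite? (δ ((t ˡ) [ last (t ˡ) ]))
      ... | inj₂ e = subst (fun (lres f) ω ≤ω_) (sym e) (_ ≤ω-top)
      -- `c23` makes f infinite at q, so the Galois connection at ω bounds the residual by q.
      ... | inj₁ (q , e) = subst (fun (lres f) ω ≤ω_) (sym e) (from (lres-galois f ω q)
              (≤ω-reflexive (sym (trans (cong (fun f) (sym e)) (trans (at-f d′)
                (c23 t (at-last d) d′ (fin⇒<ω-top e)))))))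
        where d′ = saturated (at-last d) (ˡ↝₁ _ _)

    realises-id : Realises idT idW
    realises-id = (λ d → sym (c7 _ d (arg d))) , λ _ _ → Unlimited-idW

    -- By `c8` every argument lies at or above `last ⊥T`, so `c5` reduces all values to the one at
    -- `last ⊥T`, which `c2` makes 0.
    realises-⊥ : Realises ⊥T ⊥W
    realises-⊥ = at , λ d e → ⊥-elim (0≢ω (trans (sym (last≡0 d)) e))
      where
      last≡0 : ∀ {α} → Δ (⊥T [ α ]) → δ (last ⊥T) ≡ fin 0
      last≡0 d = c8 _ d (arg (at-last d))
      at : ∀ {α} → Δ (⊥T [ α ]) → fin 0 ≡ δ (⊥T [ α ])
      at {α} d = sym (trans
        (to (last-≤⇔ d) (subst (_≤ω δ α) (sym (last≡0 d)) 0≤ω))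
        (c2 _ _ (at-last d) (arg (at-last d)) (last≡0 d)))

    realises-interp : ∀ t → Realises t (interp assignment t)
    realises-interp (var x) = realises-var x
    realises-interp (t · u) = realises-· t u (interp assignment t) (interp assignment u)
      (realises-interp t) (realises-interp u)
    realises-interp (t ᵒ)   = realises-ᵒ t (interp assignment t) (realises-interp t)
    realises-interp (t ˡ)   = realises-ˡ t (interp assignment t) (realises-interp t)
    realises-interp (t ʳ)   = realises-ʳ t (interp assignment t) (realises-interp t)
    realises-interp idT     = realises-id
    realises-interp ⊥T      = realises-⊥

  -- The two directions of the equivalence

  module _ {n} (ts : Fin n → Term) (κ : ℕ) where

    Δ : Sample → Set
    Δ = Saturation (InitSamples ts κ)

    countermodel : ¬ W⊨id≤⋁ ts →
      ∃ λ ρ → ∃ λ p → ∀ i → fun (interp ρ (ts i)) p <ω p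
    countermodel ¬valid = by-contradiction λ ¬∃ → ¬valid λ ρ fs fs-correct p →
      by-contradiction λ p≰⋁ → ¬∃ (ρ , p , λ i →
        subst (_<ω p) (interp-unique (fs-correct i) p)
          (≰ω⇒>ω λ p≤fi → p≰⋁ (≤ω-trans p≤fi (⋁-upper (λ i → fun (fs i) p) i))))

    refutation⇒diagram : ¬ W⊨id≤⋁ ts →
      ∃ λ δ → IsDiagram Δ δ × (∀ i → δ (ts i [ tvar κ ]) <ω δ (tvar κ))
    refutation⇒diagram ¬valid =
      let ρ , p , below = countermodel ¬valid in val ρ p , val-isDiagram Δ ρ p , below

    diagram⇒refutation :
      (∃ λ δ → IsDiagram Δ δ × (∀ i → δ (ts i [ tvar κ ]) <ω δ (tvar κ))) → ¬ W⊨id≤⋁ ts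
    diagram⇒refutation (δ , diagram , below) valid =
      let q , 0<q , below-q = witness ts (λ i → subst (_<ω δ (tvar κ)) (sym (at i)) (below i)) in
      <ω⇒≱ω (⋁-<ω (λ i → fun (I (ts i)) q) 0<q below-q)
        (valid assignment (I ∘ ts) (λ i → interp-correct assignment (ts i)) q)
      where
      saturated : ∀ {α β} → Δ α → α ↝ β → Δ β
      saturated (α , init , r) st = α , init , r ◅◅ (st ◅ ε)
      S = saturation-finite ts κ
      B = bounded-on-list δ (proj₁ S)
      open Realisation Δ saturated δ diagram
        (proj₁ B) (λ d → proj₂ B (proj₂ S d))
      I = interp assignment
      at : ∀ i → fun (I (ts i)) (δ (tvar κ)) ≡ δ (ts i [ tvar κ ])
      at i = proj₁ (realises-interp (ts i)) (_ , (i , refl) , ε)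
      -- If n is 0 then δ κ may be 0, so ω is used instead.
      witness : ∀ {m} (us : Fin m → Term) →
        (∀ i → fun (I (us i)) (δ (tvar κ)) <ω δ (tvar κ)) →
        ∃ λ q → fin 0 <ω q × (∀ i → fun (I (us i)) q <ω q)
      witness {zero}  us h = ω , fin<ω 0 , λ ()
      witness {suc m} us h = δ (tvar κ) , ≰ω⇒>ω (λ le → <ω⇒≱ω (h F.zero) (≤ω-trans le 0≤ω)) , h

theorem3p19 : ExcludedMiddle 0ℓ →
    ∀ {n} (ts : Fin n → Term) (κ : ℕ) →
    let Δ = Saturation (InitSamples ts κ) in
    (¬ W⊨id≤⋁ ts) ⇔
    (∃ λ (δ : Sample → ω̄) → IsDiagram Δ δ ×
    (∀ i → δ (ts i [ tvar κ ]) <ω δ (tvar κ)))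
theorem3p19 em ts κ = mk⇔ (refutation⇒diagram ts κ) (diagram⇒refutation ts κ)
  where open Classical em
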